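{- Let $n\geq 5$ be an integer and let $E(W_n)$ be the eccentricity matrix of the wheel graph $W_n$ on $n$ vertices. Then $E(W_n)$ is invertible if and only if $n\not\equiv 1\pmod 3$.
   Context: For a simple connected graph $G$ with vertices $v_1,\dots,v_n$, let $d(v_i,v_j)$ be the length of a shortest path between $v_i$ and $v_j$, and let $e(v_i)=\max\{d(v_i,v_j):1\le j\le n\}$ be the eccentricity of $v_i$. The eccentricity matrix $E(G)$ is the $n\times n$ real matrix with $(E(G))_{ij}=d(v_i,v_j)$ if $d(v_i,v_j)=\min\{e(v_i),e(v_j)\}$, and $(E(G))_{ij}=0$ otherwise. For $n\ge 4$, the wheel graph $W_n$ is the graph on $n$ vertices consisting of a cycle of length $n-1$ together with one further vertex (the hub) adjacent to every vertex of the cycle. The vertices are labelled so that $v_1$ is the hub and $v_2,\dots,v_n$ are the cycle vertices in cyclic order. -}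

module Defs where

open import Algebra.Bundles using (CommutativeRing)
open import Algebra.Structures using (IsCommutativeRing)
import Algebra.Properties.Semiring.Sum as Sum
open import Data.Bool.Base using (if_then_else_)
open import Data.Empty using (⊥)
open import Data.Fin.Base using (Fin; zero; suc; toℕ)
import Data.Fin.Properties as Fin
open import Data.Integer.Base using (+_)
open import Data.Nat.Base as ℕ using (ℕ; zero; suc; s≤s; z≤n; _⊔_; _⊓_)
import Data.Nat.Properties as ℕ
open import Data.Product.Base using (∃; ∃-syntax; _×_; _,_; proj₁; proj₂)
open import Data.Rational.Base using
  (ℚ; 0ℚ; 1ℚ; ½; _+_; _*_; _-_; -_; _/_; 1/_; ∣_∣; _<_; _≤_; positive)
import Data.Rational.Properties as ℚ
open import Data.Rational.Solver using (module +-*-Solver)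
open import Data.Sum.Base using (_⊎_; inj₁; inj₂; swap)
open import Data.Unit.Base using (⊤; tt)
open import Data.Vec.Base as Vec using (Vec; []; _∷_)
import Data.Vec.Functional as Vector
open import Data.Vec.Relation.Unary.All using ([]; _∷_)
open import Data.Vec.Relation.Unary.AllPairs using ([]; _∷_; allPairs?)
open import Data.Vec.Relation.Unary.Linked using (Linked; [-]; _∷_; linked?)
open import Data.Vec.Relation.Unary.Unique.Propositional using (Unique)
open import Function.Base using (_∘_)
open import Level using (0ℓ) renaming (_⊔_ to _⊔ˡ_)
open import Relation.Binary.Core using (Rel)
import Relation.Binary.Definitions as B
open import Relation.Binary.PropositionalEquality.Core
  using (_≡_; refl; sym; trans; cong; subst; subst₂)
open import Relation.Nullary.Decidable.Core using (Dec; yes; no; does; map′; ¬?; _×-dec_; _⊎-dec_)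
open import Relation.Nullary.Negation.Core using (¬_; contradiction)
open import Relation.Unary using (Decidable)

-- Real numbers as Cauchy sequences of rationals, with moduli; equality _≈ℝ_
-- says that the difference tends to 0.
record ℝ : Set where
  constructor mkℝ
  field
    seq    : ℕ → ℚ
    cauchy : ∀ ε → 0ℚ < ε → ∃[ N ] ∀ m n → N ℕ.≤ m → N ℕ.≤ n → ∣ seq m - seq n ∣ < ε

open ℝ

infix 4 _≈ℝ_

-- A record rather than a bare function type, so that x and y can be
-- inferred from a proof of x ≈ℝ y.
record _≈ℝ_ (x y : ℝ) : Set where
  constructor mk≈
  field
    close : ∀ ε → 0ℚ < ε → ∃[ N ] ∀ n → N ℕ.≤ n → ∣ seq x n - seq y n ∣ < ε

open _≈ℝ_

private
  0<½* : ∀ {ε} → 0ℚ < ε → 0ℚ < ½ * ε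
  0<½* {ε} 0<ε = ℚ.positive⁻¹ (½ * ε) {{ℚ.pos*pos⇒pos ½ ε {{positive 0<ε}}}}

  ½+½ : ∀ ε → ½ * ε + ½ * ε ≡ ε
  ½+½ ε = trans (sym (ℚ.*-distribʳ-+ ε ½ ½)) (ℚ.*-identityˡ ε)

  ∣p-p∣<ε : ∀ p {ε} → 0ℚ < ε → ∣ p - p ∣ < ε
  ∣p-p∣<ε p {ε} = subst (λ q → ∣ q ∣ < ε) (sym (ℚ.+-inverseʳ p))

  ∣-∣-sym : ∀ p q → ∣ p - q ∣ ≡ ∣ q - p ∣
  ∣-∣-sym p q = trans (sym (ℚ.∣-p∣≡∣p∣ (p - q)))
    (cong ∣_∣ (solve 2 (λ p q → :- (p :- q) := q :- p) refl p q))
    where open +-*-Solver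

  ∣r∣<-from : ∀ p q r {ε} → r ≡ p + q → ∣ p ∣ < ½ * ε → ∣ q ∣ < ½ * ε → ∣ r ∣ < ε
  ∣r∣<-from p q r {ε} refl p< q< =
    ℚ.≤-<-trans (ℚ.∣p+q∣≤∣p∣+∣q∣ p q) (subst (∣ p ∣ + ∣ q ∣ <_) (½+½ ε) (ℚ.+-mono-< p< q<))

  triangle : ∀ p q r {ε} → ∣ p - q ∣ < ½ * ε → ∣ q - r ∣ < ½ * ε → ∣ p - r ∣ < ε
  triangle p q r = ∣r∣<-from (p - q) (q - r) (p - r)
    (solve 3 (λ p q r → p :- r := (p :- q) :+ (q :- r)) refl p q r)
    where open +-*-Solver

  +-close : ∀ p q p′ q′ {ε} → ∣ p - p′ ∣ < ½ * ε → ∣ q - q′ ∣ < ½ * ε →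
            ∣ (p + q) - (p′ + q′) ∣ < ε
  +-close p q p′ q′ = ∣r∣<-from (p - p′) (q - q′) _
    (solve 4 (λ p q p′ q′ → (p :+ q) :- (p′ :+ q′) := (p :- p′) :+ (q :- q′)) refl p q p′ q′)
    where open +-*-Solver

  neg-close : ∀ p q → ∣ (- p) - (- q) ∣ ≡ ∣ p - q ∣
  neg-close p q = trans
    (cong ∣_∣ (solve 2 (λ p q → :- p :- (:- q) := q :- p) refl p q)) (∣-∣-sym q p)
    where open +-*-Solver

  module Scale (M : ℚ) (0<M : 0ℚ < M) where
    private instance
      posM    = positive 0<M
      nonNegM = ℚ.pos⇒nonNeg M
      nonZeroM = ℚ.pos⇒nonZero M

    scale : ℚ → ℚ
    scale ε = 1/ M * (½ * ε)

    0<scale : ∀ {ε} → 0ℚ < ε → 0ℚ < scale ε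
    0<scale {ε} 0<ε = ℚ.positive⁻¹ (scale ε)
      {{ℚ.pos*pos⇒pos (1/ M) {{ℚ.1/pos⇒pos M}} (½ * ε) {{positive (0<½* 0<ε)}}}}

    M*scale : ∀ ε → M * scale ε ≡ ½ * ε
    M*scale ε = trans (sym (ℚ.*-assoc M (1/ M) (½ * ε)))
      (trans (cong (_* (½ * ε)) (ℚ.*-inverseʳ M)) (ℚ.*-identityˡ (½ * ε)))

    term : ∀ a d {ε} → ∣ a ∣ ≤ M → ∣ d ∣ < scale ε → ∣ a * d ∣ < ½ * ε
    term a d {ε} a≤ d< = subst₂ _<_ (sym (ℚ.∣p*q∣≡∣p∣*∣q∣ a d)) (M*scale ε)
      (ℚ.≤-<-trans (ℚ.*-monoʳ-≤-nonNeg ∣ d ∣ {{ℚ.∣-∣-nonNeg d}} a≤) (ℚ.*-monoʳ-<-pos M d<))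

    *-close : ∀ a b a′ b′ {ε} → ∣ a ∣ ≤ M → ∣ b′ ∣ ≤ M →
              ∣ a - a′ ∣ < scale ε → ∣ b - b′ ∣ < scale ε → ∣ a * b - a′ * b′ ∣ < ε
    *-close a b a′ b′ {ε} a≤ b′≤ a~ b~ = ∣r∣<-from (a * (b - b′)) (b′ * (a - a′)) _
      (solve 4 (λ a b a′ b′ → a :* b :- a′ :* b′ := a :* (b :- b′) :+ b′ :* (a :- a′)) refl a b a′ b′)
      (term a (b - b′) {ε} a≤ b~) (term b′ (a - a′) {ε} b′≤ a~)
      where open +-*-Solver

  0<1 : 0ℚ < 1ℚ
  0<1 = ℚ.positive⁻¹ 1ℚ

  eventuallyBounded : ∀ x → ∃[ N ] ∃[ M ] (0ℚ < M × ∀ n → N ℕ.≤ n → ∣ seq x n ∣ ≤ M)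
  eventuallyBounded x = let N , c = cauchy x 1ℚ 0<1; s = seq x N in
    N , 1ℚ + ∣ s ∣ ,
    ℚ.<-≤-trans 0<1 (subst (_≤ 1ℚ + ∣ s ∣) (ℚ.+-identityʳ 1ℚ) (ℚ.+-monoʳ-≤ 1ℚ (ℚ.0≤∣p∣ s))) ,
    λ n N≤n → ℚ.≤-trans
      (subst (λ q → ∣ q ∣ ≤ ∣ seq x n - s ∣ + ∣ s ∣) (rearrange (seq x n) s)
        (ℚ.∣p+q∣≤∣p∣+∣q∣ (seq x n - s) s))
      (ℚ.+-monoˡ-≤ ∣ s ∣ (ℚ.<⇒≤ (c n N N≤n ℕ.≤-refl)))
    where
    open +-*-Solver
    rearrange : ∀ p q → (p - q) + q ≡ p
    rearrange = solve 2 (λ p q → (p :- q) :+ q := p) refl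

  commonBound : ∀ x y → ∃[ N ] ∃[ M ] (0ℚ < M ×
    ∀ n → N ℕ.≤ n → (∣ seq x n ∣ ≤ M) × (∣ seq y n ∣ ≤ M))
  commonBound x y =
    let N₁ , M₁ , 0<M₁ , b₁ = eventuallyBounded x
        N₂ , M₂ , 0<M₂ , b₂ = eventuallyBounded y
    in N₁ ⊔ N₂ , M₁ + M₂ , ℚ.+-mono-< 0<M₁ 0<M₂ , λ n N≤n →
      ℚ.≤-trans (b₁ n (ℕ.m⊔n≤o⇒m≤o N₁ N₂ N≤n))
        (subst (_≤ M₁ + M₂) (ℚ.+-identityʳ M₁) (ℚ.+-monoʳ-≤ M₁ (ℚ.<⇒≤ 0<M₂))) ,
      ℚ.≤-trans (b₂ n (ℕ.m⊔n≤o⇒n≤o N₁ N₂ N≤n))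
        (subst (_≤ M₁ + M₂) (ℚ.+-identityˡ M₂) (ℚ.+-monoˡ-≤ M₂ (ℚ.<⇒≤ 0<M₁)))

constℝ : ℚ → ℝ
constℝ q = mkℝ (λ _ → q) λ ε 0<ε → 0 , λ _ _ _ _ → ∣p-p∣<ε q 0<ε

0ℝ 1ℝ : ℝ
0ℝ = constℝ 0ℚ
1ℝ = constℝ 1ℚ

fromℕ : ℕ → ℝ
fromℕ k = constℝ (+ k / 1)

infixl 6 _+ℝ_
infixl 7 _*ℝ_
infix  8 -ℝ_

_+ℝ_ : ℝ → ℝ → ℝ
x +ℝ y = mkℝ (λ n → seq x n + seq y n) λ ε 0<ε →
  let N₁ , c₁ = cauchy x (½ * ε) (0<½* 0<ε)
      N₂ , c₂ = cauchy y (½ * ε) (0<½* 0<ε)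
  in N₁ ⊔ N₂ , λ m n N≤m N≤n → +-close (seq x m) (seq y m) (seq x n) (seq y n)
       (c₁ m n (ℕ.m⊔n≤o⇒m≤o N₁ N₂ N≤m) (ℕ.m⊔n≤o⇒m≤o N₁ N₂ N≤n))
       (c₂ m n (ℕ.m⊔n≤o⇒n≤o N₁ N₂ N≤m) (ℕ.m⊔n≤o⇒n≤o N₁ N₂ N≤n))

_*ℝ_ : ℝ → ℝ → ℝ
x *ℝ y = mkℝ (λ n → seq x n * seq y n) λ ε 0<ε →
  let N₀ , M , 0<M , b = commonBound x y
      open Scale M 0<M
      N₁ , c₁ = cauchy x (scale ε) (0<scale 0<ε)
      N₂ , c₂ = cauchy y (scale ε) (0<scale 0<ε)
      N₁₂ = N₁ ⊔ N₂
      to₀ : ∀ {k} → N₀ ⊔ N₁₂ ℕ.≤ k → N₀ ℕ.≤ k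
      to₀ = ℕ.m⊔n≤o⇒m≤o N₀ N₁₂
      to₁ : ∀ {k} → N₀ ⊔ N₁₂ ℕ.≤ k → N₁ ℕ.≤ k
      to₁ = ℕ.m⊔n≤o⇒m≤o N₁ N₂ ∘ ℕ.m⊔n≤o⇒n≤o N₀ N₁₂
      to₂ : ∀ {k} → N₀ ⊔ N₁₂ ℕ.≤ k → N₂ ℕ.≤ k
      to₂ = ℕ.m⊔n≤o⇒n≤o N₁ N₂ ∘ ℕ.m⊔n≤o⇒n≤o N₀ N₁₂
  in N₀ ⊔ N₁₂ , λ m n N≤m N≤n → *-close (seq x m) (seq y m) (seq x n) (seq y n)
       (proj₁ (b m (to₀ N≤m))) (proj₂ (b n (to₀ N≤n)))
       (c₁ m n (to₁ N≤m) (to₁ N≤n)) (c₂ m n (to₂ N≤m) (to₂ N≤n))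

-ℝ_ : ℝ → ℝ
-ℝ x = mkℝ (λ n → - seq x n) λ ε 0<ε →
  let N , c = cauchy x ε 0<ε
  in N , λ m n N≤m N≤n → subst (_< ε) (sym (neg-close (seq x m) (seq x n))) (c m n N≤m N≤n)

pointwise : ∀ {x y} → (∀ n → seq x n ≡ seq y n) → x ≈ℝ y
pointwise {x} {y} eq .close ε 0<ε =
  0 , λ n _ → subst (λ q → ∣ seq x n - q ∣ < ε) (eq n) (∣p-p∣<ε (seq x n) 0<ε)

≈ℝ-refl : ∀ {x} → x ≈ℝ x
≈ℝ-refl = pointwise λ _ → refl

≈ℝ-sym : ∀ {x y} → x ≈ℝ y → y ≈ℝ x
≈ℝ-sym {x} {y} x≈y .close ε 0<ε =
  let N , c = close x≈y ε 0<ε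
  in N , λ n N≤n → subst (_< ε) (∣-∣-sym (seq x n) (seq y n)) (c n N≤n)

≈ℝ-trans : ∀ {x y z} → x ≈ℝ y → y ≈ℝ z → x ≈ℝ z
≈ℝ-trans {x} {y} {z} x≈y y≈z .close ε 0<ε =
  let N₁ , c₁ = close x≈y (½ * ε) (0<½* 0<ε)
      N₂ , c₂ = close y≈z (½ * ε) (0<½* 0<ε)
  in N₁ ⊔ N₂ , λ n N≤n → triangle (seq x n) (seq y n) (seq z n)
       (c₁ n (ℕ.m⊔n≤o⇒m≤o N₁ N₂ N≤n)) (c₂ n (ℕ.m⊔n≤o⇒n≤o N₁ N₂ N≤n))

+ℝ-cong : ∀ {x x′ y y′} → x ≈ℝ x′ → y ≈ℝ y′ → x +ℝ y ≈ℝ x′ +ℝ y′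
+ℝ-cong {x} {x′} {y} {y′} x≈ y≈ .close ε 0<ε =
  let N₁ , c₁ = close x≈ (½ * ε) (0<½* 0<ε)
      N₂ , c₂ = close y≈ (½ * ε) (0<½* 0<ε)
  in N₁ ⊔ N₂ , λ n N≤n → +-close (seq x n) (seq y n) (seq x′ n) (seq y′ n)
       (c₁ n (ℕ.m⊔n≤o⇒m≤o N₁ N₂ N≤n)) (c₂ n (ℕ.m⊔n≤o⇒n≤o N₁ N₂ N≤n))

*ℝ-cong : ∀ {x x′ y y′} → x ≈ℝ x′ → y ≈ℝ y′ → x *ℝ y ≈ℝ x′ *ℝ y′
*ℝ-cong {x} {x′} {y} {y′} x≈ y≈ .close ε 0<ε =
  let N₀ , M , 0<M , b = commonBound x y′
      open Scale M 0<M
      N₁ , c₁ = close x≈ (scale ε) (0<scale 0<ε)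
      N₂ , c₂ = close y≈ (scale ε) (0<scale 0<ε)
      N₁₂ = N₁ ⊔ N₂
  in N₀ ⊔ N₁₂ , λ n N≤n →
    let N₀≤n = ℕ.m⊔n≤o⇒m≤o N₀ N₁₂ N≤n
        N₁₂≤n = ℕ.m⊔n≤o⇒n≤o N₀ N₁₂ N≤n
    in *-close (seq x n) (seq y n) (seq x′ n) (seq y′ n)
         (proj₁ (b n N₀≤n)) (proj₂ (b n N₀≤n))
         (c₁ n (ℕ.m⊔n≤o⇒m≤o N₁ N₂ N₁₂≤n)) (c₂ n (ℕ.m⊔n≤o⇒n≤o N₁ N₂ N₁₂≤n))

-ℝ-cong : ∀ {x y} → x ≈ℝ y → -ℝ x ≈ℝ -ℝ y
-ℝ-cong {x} {y} x≈y .close ε 0<ε =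
  let N , c = close x≈y ε 0<ε
  in N , λ n N≤n → subst (_< ε) (sym (neg-close (seq x n) (seq y n))) (c n N≤n)

ℝ-isCommutativeRing : IsCommutativeRing _≈ℝ_ _+ℝ_ _*ℝ_ -ℝ_ 0ℝ 1ℝ
ℝ-isCommutativeRing = record
  { isRing = record
    { +-isAbelianGroup = record
      { isGroup = record
        { isMonoid = record
          { isSemigroup = record
            { isMagma = record
              { isEquivalence = record { refl = ≈ℝ-refl ; sym = ≈ℝ-sym ; trans = ≈ℝ-trans }
              ; ∙-cong = +ℝ-cong
              }
            ; assoc = λ x y z → pointwise λ n → ℚ.+-assoc (seq x n) (seq y n) (seq z n)
            }
          ; identity = (λ x → pointwise λ n → ℚ.+-identityˡ (seq x n))
                     , (λ x → pointwise λ n → ℚ.+-identityʳ (seq x n))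
          }
        ; inverse = (λ x → pointwise λ n → ℚ.+-inverseˡ (seq x n))
                  , (λ x → pointwise λ n → ℚ.+-inverseʳ (seq x n))
        ; ⁻¹-cong = -ℝ-cong
        }
      ; comm = λ x y → pointwise λ n → ℚ.+-comm (seq x n) (seq y n)
      }
    ; *-cong = *ℝ-cong
    ; *-assoc = λ x y z → pointwise λ n → ℚ.*-assoc (seq x n) (seq y n) (seq z n)
    ; *-identity = (λ x → pointwise λ n → ℚ.*-identityˡ (seq x n))
                 , (λ x → pointwise λ n → ℚ.*-identityʳ (seq x n))
    ; distrib = (λ x y z → pointwise λ n → ℚ.*-distribˡ-+ (seq x n) (seq y n) (seq z n))
              , (λ x y z → pointwise λ n → ℚ.*-distribʳ-+ (seq x n) (seq y n) (seq z n))
    }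
  ; *-comm = λ x y → pointwise λ n → ℚ.*-comm (seq x n) (seq y n)
  }

ℝ-commutativeRing : CommutativeRing 0ℓ 0ℓ
ℝ-commutativeRing = record { isCommutativeRing = ℝ-isCommutativeRing }

Matrix : ∀ {a} → Set a → ℕ → Set a
Matrix A n = Fin n → Fin n → A

module _ {c ℓ} (R : CommutativeRing c ℓ) where
  open CommutativeRing R using (Carrier; _≈_; 0#; 1#; semiring) renaming (_*_ to _·_)
  open Sum semiring using (sum)

  identityMatrix : ∀ {n} → Matrix Carrier n
  identityMatrix i j = if does (i Fin.≟ j) then 1# else 0#

  matrixProduct : ∀ {n} → Matrix Carrier n → Matrix Carrier n → Matrix Carrier n
  matrixProduct A B i j = sum λ k → A i k · B k j

  MatrixEq : ∀ {n} → Matrix Carrier n → Matrix Carrier n → Set ℓ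
  MatrixEq A B = ∀ i j → A i j ≈ B i j

  Invertible : ∀ {n} → Matrix Carrier n → Set (c ⊔ˡ ℓ)
  Invertible A = ∃[ B ] (MatrixEq (matrixProduct A B) identityMatrix
                       × MatrixEq (matrixProduct B A) identityMatrix)

record SimpleGraph (n : ℕ) : Set₁ where
  field
    Adj     : Rel (Fin n) 0ℓ
    adj?    : B.Decidable Adj
    irrefl  : ∀ v → ¬ Adj v v
    adj-sym : B.Symmetric Adj

record IsPath {n} (G : SimpleGraph n) (u v : Fin n) {k} (p : Vec (Fin n) (suc k)) : Set where
  constructor isPath
  open SimpleGraph G
  field
    starts   : Vec.head p ≡ u
    ends     : Vec.last p ≡ v
    linked   : Linked Adj p
    distinct : Unique p

-- A path of length k has k edges, hence k + 1 vertices.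
HasPath : ∀ {n} → SimpleGraph n → Fin n → Fin n → ℕ → Set
HasPath {n} G u v k = ∃ λ (p : Vec (Fin n) (suc k)) → IsPath G u v p

Connected : ∀ {n} → SimpleGraph n → Set
Connected G = ∀ u v → ∃ (HasPath G u v)

anyVec? : ∀ {p n k} {P : Vec (Fin n) k → Set p} → Decidable P → Dec (∃ P)
anyVec? {k = zero}  P? = map′ (λ p → [] , p) (λ { ([] , p) → p }) (P? [])
anyVec? {k = suc k} P? = map′ (λ { (x , xs , p) → x ∷ xs , p }) (λ { (x ∷ xs , p) → x , xs , p })
  (Fin.any? λ x → anyVec? λ xs → P? (x ∷ xs))

hasPath? : ∀ {n} (G : SimpleGraph n) u v → Decidable (HasPath G u v)
hasPath? G u v k = anyVec? λ p →
  map′ (λ { (a , b , c , d) → isPath a b c d }) (λ { (isPath a b c d) → a , b , c , d })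
    ((Vec.head p Fin.≟ u) ×-dec (Vec.last p Fin.≟ v) ×-dec
     linked? (SimpleGraph.adj? G) p ×-dec allPairs? (λ x y → ¬? (x Fin.≟ y)) p)

least : ∀ {p} {P : ℕ → Set p} → Decidable P → ∀ n → P n → ∃[ k ] (P k × (∀ j → P j → k ℕ.≤ j))
least P? n pn with P? 0
least P? n       pn | yes p0 = 0 , p0 , λ _ _ → z≤n
least P? zero    pn | no ¬p0 = contradiction pn ¬p0
least P? (suc n) pn | no ¬p0 =
  let k , pk , k≤ = least (P? ∘ suc) n pn
  in suc k , pk , λ { zero p0 → contradiction p0 ¬p0 ; (suc j) pj → s≤s (k≤ j pj) }

-- The value does not depend on which connectedness proof is supplied:
-- it only bounds the search for a shortest path.
distance : ∀ {n} (G : SimpleGraph n) → Connected G → Fin n → Fin n → ℕ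
distance G conn u v =
  let k , path = conn u v
  in proj₁ (least (hasPath? G u v) k path)

eccentricity : ∀ {n} (G : SimpleGraph n) → Connected G → Fin n → ℕ
eccentricity G conn v = Vector.foldr _⊔_ 0 (distance G conn v)

eccentricityMatrix : ∀ {n} (G : SimpleGraph n) → Connected G → Matrix ℝ n
eccentricityMatrix G conn i j =
  if does (d ℕ.≟ eccentricity G conn i ⊓ eccentricity G conn j) then fromℕ d else 0ℝ
  where d = distance G conn i j

CyclicNext : ∀ {m} → Rel (Fin m) 0ℓ
CyclicNext {m} i j = toℕ j ≡ suc (toℕ i) ⊎ (suc (toℕ i) ≡ m × toℕ j ≡ 0)

-- The hub is zero; the cycle vertices are suc i in cyclic order.
WheelAdj : ∀ {n} → Rel (Fin n) 0ℓ
WheelAdj zero    zero    = ⊥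
WheelAdj zero    (suc j) = ⊤
WheelAdj (suc i) zero    = ⊤
WheelAdj (suc i) (suc j) = CyclicNext i j ⊎ CyclicNext j i

private
  cyclicNext? : ∀ {m} → B.Decidable (CyclicNext {m})
  cyclicNext? {m} i j =
    (toℕ j ℕ.≟ suc (toℕ i)) ⊎-dec ((suc (toℕ i) ℕ.≟ m) ×-dec (toℕ j ℕ.≟ 0))

  wheelAdj? : ∀ {n} → B.Decidable (WheelAdj {n})
  wheelAdj? zero    zero    = no λ ()
  wheelAdj? zero    (suc j) = yes tt
  wheelAdj? (suc i) zero    = yes tt
  wheelAdj? (suc i) (suc j) = cyclicNext? i j ⊎-dec cyclicNext? j i

  wheelAdj-sym : ∀ {n} → B.Symmetric (WheelAdj {n})
  wheelAdj-sym {_} {zero}  {suc j} _ = tt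
  wheelAdj-sym {_} {suc i} {zero}  _ = tt
  wheelAdj-sym {_} {suc i} {suc j} a = swap a

  cyclicNext-irrefl : ∀ {m} → 3 ℕ.≤ m → (i : Fin m) → ¬ CyclicNext i i
  cyclicNext-irrefl 3≤m i (inj₁ eq) = ℕ.1+n≢n (sym eq)
  cyclicNext-irrefl 3≤m i (inj₂ (eq , i≡0)) with trans (sym eq) (cong suc i≡0)
  cyclicNext-irrefl (s≤s ()) i (inj₂ (eq , i≡0)) | refl

  wheelAdj-irrefl : ∀ {n} → 4 ℕ.≤ n → (v : Fin n) → ¬ WheelAdj v v
  wheelAdj-irrefl _         zero    ()
  wheelAdj-irrefl (s≤s 3≤m) (suc i) (inj₁ a) = cyclicNext-irrefl 3≤m i a
  wheelAdj-irrefl (s≤s 3≤m) (suc i) (inj₂ a) = cyclicNext-irrefl 3≤m i a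

wheel : ∀ n → 4 ℕ.≤ n → SimpleGraph n
wheel n 4≤n = record
  { Adj     = WheelAdj
  ; adj?    = wheelAdj?
  ; irrefl  = wheelAdj-irrefl 4≤n
  ; adj-sym = wheelAdj-sym
  }

wheel-connected : ∀ n (4≤n : 4 ℕ.≤ n) → Connected (wheel n 4≤n)
wheel-connected n 4≤n u v with u Fin.≟ v
wheel-connected n 4≤n u       .u      | yes refl = 0 , u ∷ [] , isPath refl refl [-] ([] ∷ [])
wheel-connected n 4≤n zero    zero    | no 0≢0 = contradiction refl 0≢0
wheel-connected n 4≤n zero    (suc j) | no 0≢j =
  1 , zero ∷ suc j ∷ [] , isPath refl refl (tt ∷ [-]) ((0≢j ∷ []) ∷ [] ∷ [])
wheel-connected n 4≤n (suc i) zero    | no i≢0 =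
  1 , suc i ∷ zero ∷ [] , isPath refl refl (tt ∷ [-]) ((i≢0 ∷ []) ∷ [] ∷ [])
wheel-connected n 4≤n (suc i) (suc j) | no i≢j =
  2 , suc i ∷ zero ∷ suc j ∷ [] , isPath refl refl (tt ∷ tt ∷ [-])
    (((λ ()) ∷ i≢j ∷ []) ∷ ((λ ()) ∷ []) ∷ [] ∷ [])

{-# OPTIONS --safe #-}
module Submission where

-- Apart from a hub row and column of ones, the matrix is 2(J − A), where A is the
-- circulant matrix of closed neighbourhoods on the cycle of length m = n − 1; its row
-- sums are 3. If 3 ∣ m, the vector (0; 1, −1, 0, 1, −1, 0, …) lies in the kernel.
-- Otherwise A has an inverse P with entries p ∣i − j∣ for a sequence p of period 3
-- that sums to 0 over a period, and the bordered matrix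
-- [ 6/m − 2 , 1/m ; 1/m , J/6m − P/2 ] is the inverse of the eccentricity matrix.
-- Both witnesses are rational, hence serve over ℝ as well.

open import Algebra.Bundles using (CommutativeRing)
import Algebra.Properties.Semiring.Sum as Sum
open import Data.Bool.Base using (true; false; if_then_else_)
open import Data.Fin.Base using (Fin; zero; suc; toℕ; fromℕ<; inject₁)
import Data.Fin.Properties as Fin
import Data.Integer.Base as ℤ
open import Data.Nat using (ℕ; _≤_; _%_)
open import Data.Nat.Base as ℕ using (zero; suc; z≤n; s≤s)
open import Data.Nat.Properties using (<⇒≤)
import Data.Nat.Properties as ℕ
open import Data.Nat.DivMod using (m≡m%n+[m/n]*n; m%n<n)
open import Data.Product.Base using (∃; _×_; _,_; proj₁; proj₂)
open import Data.Rational.Base using (ℚ; 0ℚ; 1ℚ; ½; _+_; _*_; _-_; -_; _/_; 1/_; Positive)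
import Data.Rational.Properties as ℚ
open import Data.Rational.Solver using (module +-*-Solver)
open import Data.Sum.Base using (_⊎_; inj₁; inj₂)
open import Data.Unit.Base using (tt)
open import Data.Vec.Base using ([]; _∷_)
import Data.Vec.Functional as Vector
open import Data.Vec.Relation.Unary.All using ([]; _∷_)
open import Data.Vec.Relation.Unary.AllPairs using ([]; _∷_)
open import Data.Vec.Relation.Unary.Linked using ([-]; _∷_)
open import Function.Base using (_∘_)
open import Function.Bundles using (_⇔_; mk⇔)
import Relation.Binary.Reasoning.Setoid as SetoidReasoning
open import Relation.Binary.PropositionalEquality
  using (_≡_; _≢_; refl; sym; trans; cong; cong₂; subst; module ≡-Reasoning)
open import Relation.Nullary.Decidable using (yes; no; does; dec-true; dec-false; does-⇔)
open import Relation.Nullary.Negation using (¬_; contradiction)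
open import Defs

-- Matrices over a commutative ring

module _ {c ℓ} (R : CommutativeRing c ℓ) where
  open CommutativeRing R using (Carrier; _≈_; 0#; setoid; semiring; zeroˡ; zeroʳ; +-cong;
    *-congˡ; *-congʳ; *-assoc; *-identityˡ; +-identityˡ; +-identityʳ)
    renaming (_*_ to _·_; refl to ≈-refl; sym to ≈-sym; trans to ≈-trans)
  open Sum semiring

  sum-zero : ∀ {n} {f : Fin n → Carrier} → (∀ k → f k ≈ 0#) → sum f ≈ 0#
  sum-zero {n} f≈0 = ≈-trans (sum-cong-≋ f≈0) (sum-replicate-zero n)

  sum-identityMatrix : ∀ {n} (i : Fin n) (v : Fin n → Carrier) →
                       sum (λ j → identityMatrix R i j · v j) ≈ v i
  sum-identityMatrix zero v = ≈-trans
    (+-cong (*-identityˡ (v zero)) (sum-zero λ k → zeroˡ (v (suc k)))) (+-identityʳ (v zero))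
  sum-identityMatrix (suc i) v = ≈-trans
    (+-cong (zeroˡ (v zero)) (sum-identityMatrix i (v ∘ suc))) (+-identityˡ (v (suc i)))

  -- `v = (BM)v = B(Mv) = 0`, with the associativity of the products written out as an exchange of
  -- sums.
  invertible⇒trivialKernel : ∀ {n} {M : Matrix Carrier n} → Invertible R M →
    (v : Fin n → Carrier) → (∀ i → sum (λ j → M i j · v j) ≈ 0#) → ∀ i → v i ≈ 0#
  invertible⇒trivialKernel {n} {M} (B , _ , BM≈I) v Mv≈0 i = begin
    v i                                                 ≈⟨ sum-identityMatrix i v ⟨
    ∑[ j < n ] (identityMatrix R i j · v j)             ≈⟨ sum-cong-≋ (λ j → *-congʳ (BM≈I i j)) ⟨
    ∑[ j < n ] (∑[ k < n ] (B i k · M k j) · v j)       ≈⟨ sum-cong-≋ (λ j → *-distribʳ-sum (v j) (λ k → B i k · M k j)) ⟩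
    ∑[ j < n ] (∑[ k < n ] (B i k · M k j · v j))       ≈⟨ ∑-comm (λ j k → B i k · M k j · v j) ⟩
    ∑[ k < n ] (∑[ j < n ] (B i k · M k j · v j))       ≈⟨ sum-cong-≋ (λ k → sum-cong-≋ λ j → *-assoc (B i k) (M k j) (v j)) ⟩
    ∑[ k < n ] (∑[ j < n ] (B i k · (M k j · v j)))     ≈⟨ sum-cong-≋ (λ k → *-distribˡ-sum (B i k) (λ j → M k j · v j)) ⟨
    ∑[ k < n ] (B i k · ∑[ j < n ] (M k j · v j))       ≈⟨ sum-zero (λ k → ≈-trans (*-congˡ (Mv≈0 k)) (zeroʳ (B i k))) ⟩
    0#                                                  ∎
    where open SetoidReasoning setoid

  -- Transposing `MB = I` gives `BM = I`, so for symmetric matrices a single product has to be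
  -- computed.
  symmetric-inverse : ∀ {n} {M B : Matrix Carrier n} →
    (∀ i j → M i j ≈ M j i) → (∀ i j → B i j ≈ B j i) →
    MatrixEq R (matrixProduct R M B) (identityMatrix R) → MatrixEq R (matrixProduct R B M) (identityMatrix R)
  symmetric-inverse {n} {M} {B} M-sym B-sym MB≈I i j = begin
    ∑[ k < n ] (B i k · M k j)   ≈⟨ sum-cong-≋ (λ k → CommutativeRing.*-cong R (B-sym i k) (M-sym k j)) ⟩
    ∑[ k < n ] (B k i · M j k)   ≈⟨ sum-cong-≋ (λ k → CommutativeRing.*-comm R (B k i) (M j k)) ⟩
    ∑[ k < n ] (M j k · B k i)   ≈⟨ MB≈I j i ⟩
    identityMatrix R j i         ≡⟨ cong (if_then _ else _) (does-⇔ (mk⇔ sym sym) (j Fin.≟ i) (i Fin.≟ j)) ⟩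
    identityMatrix R i j         ∎
    where open SetoidReasoning setoid

-- Kronecker deltas and linear combinations of rational sums

open Sum (CommutativeRing.semiring ℚ.+-*-commutativeRing)

δ : ∀ {n} → Matrix ℚ n
δ = identityMatrix ℚ.+-*-commutativeRing

δ-≡ : ∀ {n} {i j : Fin n} → i ≡ j → δ i j ≡ 1ℚ
δ-≡ {i = i} {j} i≡j = cong (if_then 1ℚ else 0ℚ) (dec-true (i Fin.≟ j) i≡j)

δ-≢ : ∀ {n} {i j : Fin n} → i ≢ j → δ i j ≡ 0ℚ
δ-≢ {i = i} {j} i≢j = cong (if_then 1ℚ else 0ℚ) (dec-false (i Fin.≟ j) i≢j)

δ-cong : ∀ {m n} {i j : Fin m} {k l : Fin n} → (i ≡ j → k ≡ l) → (k ≡ l → i ≡ j) → δ i j ≡ δ k l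
δ-cong {i = i} {j} {k} {l} f g = cong (if_then 1ℚ else 0ℚ) (does-⇔ (mk⇔ f g) (i Fin.≟ j) (k Fin.≟ l))

∑-linear : ∀ {n} a b (f g : Fin n → ℚ) → ∑[ k < n ] (a * f k + b * g k) ≡ a * sum f + b * sum g
∑-linear a b f g = trans (∑-distrib-+ (λ k → a * f k) (λ k → b * g k))
  (sym (cong₂ _+_ (*-distribˡ-sum a f) (*-distribˡ-sum b g)))

-- From rational to real matrices

-- Both rings are abstract because, with ℝ in place of S, Agda would compare sums
-- by unfolding the arithmetic of Cauchy sequences.
module _ {a b c ℓ} (R : CommutativeRing a b) (S : CommutativeRing c ℓ) where
  private
    module R = CommutativeRing R
    module S = CommutativeRing S
    module ∑R = Sum R.semiring
    module ∑S = Sum S.semiring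

  module _ (h : R.Carrier → S.Carrier)
    (h-cong : ∀ {x y} → x R.≈ y → h x S.≈ h y)
    (h-0 : h R.0# S.≈ S.0#) (h-1 : h R.1# S.≈ S.1#)
    (h-+ : ∀ x y → h (x R.+ y) S.≈ h x S.+ h y)
    (h-* : ∀ x y → h (x R.* y) S.≈ h x S.* h y) where

    sum-map : ∀ {n} (f : Fin n → R.Carrier) → h (∑R.sum f) S.≈ ∑S.sum (h ∘ f)
    sum-map {zero}  f = h-0
    sum-map {suc n} f = S.trans (h-+ _ _) (S.+-congˡ (sum-map (f ∘ suc)))

    sum-products-map : ∀ {n} {f g : Fin n → S.Carrier} {f′ g′ : Fin n → R.Carrier} →
      (∀ k → f k S.≈ h (f′ k)) → (∀ k → g k S.≈ h (g′ k)) →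
      ∑S.sum (λ k → f k S.* g k) S.≈ h (∑R.sum λ k → f′ k R.* g′ k)
    sum-products-map {f′ = f′} {g′} f≈ g≈ = S.trans
      (∑S.sum-cong-≋ λ k → S.trans (S.*-cong (f≈ k) (g≈ k)) (S.sym (h-* (f′ k) (g′ k))))
      (S.sym (sum-map λ k → f′ k R.* g′ k))

    identityMatrix-map : ∀ {n} (i j : Fin n) → h (identityMatrix R i j) S.≈ identityMatrix S i j
    identityMatrix-map i j with does (i Fin.≟ j)
    ... | true  = h-1
    ... | false = h-0

    module _ {n} {M : Matrix S.Carrier n} {M′ : Matrix R.Carrier n} (M≈ : MatrixEq S M (λ i j → h (M′ i j))) where

      Invertible-map : Invertible R M′ → Invertible S M
      Invertible-map (B , MB≈I , BM≈I) = (λ i j → h (B i j)) ,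
        (λ i j → S.trans (sum-products-map (M≈ i) λ _ → S.refl) (lift i j (MB≈I i j))) ,
        (λ i j → S.trans (sum-products-map (λ _ → S.refl) λ k → M≈ k j) (lift i j (BM≈I i j)))
        where
        lift : ∀ {x} i j → x R.≈ identityMatrix R i j → h x S.≈ identityMatrix S i j
        lift i j x≈δ = S.trans (h-cong x≈δ) (identityMatrix-map i j)

      -- If `M` were invertible, the image of `v` would vanish; an entry equal to 1 turns this into
      -- `1 ≈ 0` in `S`.
      singular-map : (v : Fin n → R.Carrier) → (∀ i → ∑R.sum (λ j → M′ i j R.* v j) R.≈ R.0#) →
        ∀ i → v i R.≈ R.1# → ¬ S.1# S.≈ S.0# → ¬ Invertible S M
      singular-map v M′v≈0 i vᵢ≈1 1≉0 M-invertible = 1≉0 (S.trans (S.sym (S.trans (h-cong vᵢ≈1) h-1))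
        (invertible⇒trivialKernel S M-invertible (h ∘ v)
          (λ i → S.trans (sum-products-map (M≈ i) λ _ → S.refl) (S.trans (h-cong (M′v≈0 i)) h-0)) i))

constℝ-cong : ∀ {p q} → p ≡ q → constℝ p ≈ℝ constℝ q
constℝ-cong refl = ≈ℝ-refl

1≉0 : ¬ (1ℝ ≈ℝ 0ℝ)
-- For `ε = 1` the constant difference has absolute value exactly 1, which is not below `ε`.
1≉0 1≈0 = let N , c = _≈ℝ_.close 1≈0 1ℚ (ℚ.positive⁻¹ 1ℚ) in ℚ.<-irrefl refl (c N ℕ.≤-refl)

module _ {n} {M : Matrix ℝ n} {M′ : Matrix ℚ n} (M≈ : ∀ i j → M i j ≈ℝ constℝ (M′ i j)) where

  Invertible-constℝ : Invertible ℚ.+-*-commutativeRing M′ → Invertible ℝ-commutativeRing M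
  Invertible-constℝ = Invertible-map ℚ.+-*-commutativeRing ℝ-commutativeRing constℝ constℝ-cong
    ≈ℝ-refl ≈ℝ-refl (λ _ _ → pointwise λ _ → refl) (λ _ _ → pointwise λ _ → refl) {M = M} {M′ = M′} M≈

  singular-constℝ : (v : Fin n → ℚ) → (∀ i → ∑[ j < n ] (M′ i j * v j) ≡ 0ℚ) →
    ∀ i → v i ≡ 1ℚ → ¬ Invertible ℝ-commutativeRing M
  singular-constℝ v M′v≡0 i vᵢ≡1 = singular-map ℚ.+-*-commutativeRing ℝ-commutativeRing constℝ constℝ-cong
    ≈ℝ-refl ≈ℝ-refl (λ _ _ → pointwise λ _ → refl) (λ _ _ → pointwise λ _ → refl) {M = M} {M′ = M′} M≈ v M′v≡0 i vᵢ≡1 1≉0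

-- The bordered matrix

2ℚ 3ℚ 6ℚ ⅓ ⅙ : ℚ
2ℚ = ℤ.+ 2 / 1
3ℚ = ℤ.+ 3 / 1
6ℚ = ℤ.+ 6 / 1
⅓ = ℤ.+ 1 / 3
⅙ = ℤ.+ 1 / 6

bordered : ∀ {m} → Matrix ℚ m → Matrix ℚ (suc m)
bordered A zero    zero    = 0ℚ
bordered A zero    (suc j) = 1ℚ
bordered A (suc i) zero    = 1ℚ
bordered A (suc i) (suc j) = 2ℚ * (1ℚ - A i j)

-- The block is `2J − 2A`, so its action on `v` depends only on the total of `v` and on `A v`. The
-- kernel and the inverse are both computed from these two quantities.
∑-bordered : ∀ {m} (A : Matrix ℚ m) i (v : Fin m → ℚ) →
  ∑[ k < m ] (2ℚ * (1ℚ - A i k) * v k) ≡ 2ℚ * sum v + (- 2ℚ) * ∑[ k < m ] (A i k * v k)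
∑-bordered A i v = trans
  (sum-cong-≗ λ k → solve 2 (λ a v → con 2ℚ :* (con 1ℚ :- a) :* v := con 2ℚ :* v :+ con (- 2ℚ) :* (a :* v)) refl (A i k) (v k))
  (∑-linear 2ℚ (- 2ℚ) v (λ k → A i k * v k))
  where open +-*-Solver

bordered-kernel : ∀ {m} (A : Matrix ℚ m) (v : Fin m → ℚ) → sum v ≡ 0ℚ →
  (∀ i → ∑[ k < m ] (A i k * v k) ≡ 0ℚ) →
  ∀ i → ∑[ k < suc m ] (bordered A i k * (0ℚ Vector.∷ v) k) ≡ 0ℚ
bordered-kernel A v ∑v≡0 Av≡0 zero    = cong (0ℚ +_)
  (trans (sum-cong-≗ λ k → ℚ.*-identityˡ (v k)) ∑v≡0)
bordered-kernel A v ∑v≡0 Av≡0 (suc i) = cong (0ℚ +_)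
  (trans (∑-bordered A i v) (cong₂ (λ x y → 2ℚ * x + (- 2ℚ) * y) ∑v≡0 (Av≡0 i)))

-- The cycle length enters as a sum of ones, so that its reciprocal `w` can be handled by
-- distributivity; positivity makes that reciprocal available.
0<∑1 : ∀ m → Positive (∑[ k < suc m ] 1ℚ)
0<∑1 zero    = _
0<∑1 (suc m) = ℚ.pos+pos⇒pos 1ℚ (∑[ k < suc m ] 1ℚ) {{0<∑1 m}}

module _ {m} (A P : Matrix ℚ (suc m)) (A-sym : ∀ i j → A i j ≡ A j i) (P-sym : ∀ i j → P i j ≡ P j i)
  (A-rowSum : ∀ i → sum (A i) ≡ 3ℚ) (AP≡I : ∀ i j → ∑[ k < suc m ] (A i k * P k j) ≡ δ i j) where

  open ≡-Reasoning
  open +-*-Solver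

  private
    instance
      nonZero = ℚ.pos⇒nonZero (∑[ k < suc m ] 1ℚ) {{0<∑1 m}}

    w : ℚ
    w = 1/ (∑[ k < suc m ] 1ℚ)

    ∑w : ∑[ k < suc m ] w ≡ 1ℚ
    ∑w = begin
      ∑[ k < suc m ] w          ≡⟨ sum-cong-≗ {suc m} (λ _ → sym (ℚ.*-identityˡ w)) ⟩
      ∑[ k < suc m ] (1ℚ * w)   ≡⟨ *-distribʳ-sum {suc m} w (λ _ → 1ℚ) ⟨
      ∑[ k < suc m ] 1ℚ * w     ≡⟨ ℚ.*-inverseʳ (∑[ k < suc m ] 1ℚ) ⟩
      1ℚ                        ∎

    -- By symmetry the columns of `A` also sum to 3. Adding up column `j` of `A P = I` therefore
    -- gives three times the column sum of `P` on one side and 1 on the other.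
    P-colSum : ∀ j → ∑[ k < suc m ] P k j ≡ ⅓
    P-colSum j = begin
      ∑[ k < suc m ] P k j                                    ≡⟨ solve 1 (λ x → x := con ⅓ :* (con 3ℚ :* x)) refl _ ⟩
      ⅓ * (3ℚ * ∑[ k < suc m ] P k j)                         ≡⟨ cong (⅓ *_) (*-distribˡ-sum 3ℚ (λ k → P k j)) ⟩
      ⅓ * ∑[ k < suc m ] (3ℚ * P k j)                         ≡⟨ cong (⅓ *_) (sum-cong-≗ λ k → cong (_* P k j) (sym (A-rowSum k))) ⟩
      ⅓ * ∑[ k < suc m ] (sum (A k) * P k j)                  ≡⟨ cong (⅓ *_) (sum-cong-≗ λ k → *-distribʳ-sum (P k j) (A k)) ⟩
      ⅓ * ∑[ k < suc m ] (∑[ i < suc m ] (A k i * P k j))     ≡⟨ cong (⅓ *_) (∑-comm (λ k i → A k i * P k j)) ⟩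
      ⅓ * ∑[ i < suc m ] (∑[ k < suc m ] (A k i * P k j))     ≡⟨ cong (⅓ *_) (sum-cong-≗ λ i → trans (sum-cong-≗ λ k → cong (_* P k j) (A-sym k i)) (AP≡I i j)) ⟩
      ⅓ * ∑[ i < suc m ] δ i j                                ≡⟨ cong (⅓ *_) (sum-cong-≗ λ i → trans (δ-cong {i = i} {j} {j} {i} sym sym) (sym (ℚ.*-identityʳ (δ j i)))) ⟩
      ⅓ * ∑[ i < suc m ] (δ j i * 1ℚ)                         ≡⟨ cong (⅓ *_) (sum-identityMatrix ℚ.+-*-commutativeRing j (λ _ → 1ℚ)) ⟩
      ⅓                                                       ∎

    -- The term `(- ½) * P` inverts `−2A`. The constant `⅙ * w` is the correction that makes every
    -- column sum vanish: `⅙ − ½ · ⅓ = 0`.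
    Q : Matrix ℚ (suc m)
    Q i j = ⅙ * w + (- ½) * P i j

    Q-colSum : ∀ j → ∑[ k < suc m ] Q k j ≡ 0ℚ
    Q-colSum j = trans (∑-linear ⅙ (- ½) (λ _ → w) (λ k → P k j))
      (cong₂ (λ x y → ⅙ * x + (- ½) * y) ∑w (P-colSum j))

    -- Multiplied by -2 this is `δ i j − w`, and the `w` is cancelled by the border column of
    -- `bordered A`.
    AQ : ∀ i j → ∑[ k < suc m ] (A i k * Q k j) ≡ ½ * w + (- ½) * δ i j
    AQ i j = begin
      ∑[ k < suc m ] (A i k * Q k j)                            ≡⟨ sum-cong-≗ (λ k → solve 3 (λ a w p → a :* (con ⅙ :* w :+ con (- ½) :* p) := con ⅙ :* w :* a :+ con (- ½) :* (a :* p)) refl (A i k) w (P k j)) ⟩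
      ∑[ k < suc m ] (⅙ * w * A i k + (- ½) * (A i k * P k j))  ≡⟨ ∑-linear (⅙ * w) (- ½) (A i) (λ k → A i k * P k j) ⟩
      ⅙ * w * sum (A i) + (- ½) * ∑[ k < suc m ] (A i k * P k j) ≡⟨ cong₂ (λ x y → ⅙ * w * x + (- ½) * y) (A-rowSum i) (AP≡I i j) ⟩
      ⅙ * w * 3ℚ + (- ½) * δ i j                                ≡⟨ cong (_+ (- ½) * δ i j) (solve 1 (λ w → con ⅙ :* w :* con 3ℚ := con ½ :* w) refl w) ⟩
      ½ * w + (- ½) * δ i j                                     ∎

    inverse : Matrix ℚ (suc (suc m))
    -- The corner is forced by the rim rows against the first column: `x + 2 · 1 − 2 · 3w = 0`.
    inverse zero    zero    = 6ℚ * w - 2ℚ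
    inverse zero    (suc j) = w
    inverse (suc i) zero    = w
    inverse (suc i) (suc j) = Q i j

    bordered-inverse : ∀ i j → ∑[ k < suc (suc m) ] (bordered A i k * inverse k j) ≡ δ i j
    bordered-inverse zero zero = begin
      0ℚ * (6ℚ * w - 2ℚ) + ∑[ k < suc m ] (1ℚ * w)   ≡⟨ cong₂ _+_ (ℚ.*-zeroˡ (6ℚ * w - 2ℚ)) (trans (sum-cong-≗ {suc m} λ _ → ℚ.*-identityˡ w) ∑w) ⟩
      0ℚ + 1ℚ ∎
    bordered-inverse zero (suc j) = cong₂ _+_ (ℚ.*-zeroˡ w)
      (trans (sum-cong-≗ λ k → ℚ.*-identityˡ (Q k j)) (Q-colSum j))
    bordered-inverse (suc i) zero = begin
      1ℚ * (6ℚ * w - 2ℚ) + ∑[ k < suc m ] (2ℚ * (1ℚ - A i k) * w)             ≡⟨ cong (_+_ (1ℚ * (6ℚ * w - 2ℚ))) (∑-bordered A i (λ _ → w)) ⟩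
      1ℚ * (6ℚ * w - 2ℚ) + (2ℚ * ∑[ k < suc m ] w + (- 2ℚ) * ∑[ k < suc m ] (A i k * w))
        ≡⟨ cong₂ (λ x y → 1ℚ * (6ℚ * w - 2ℚ) + (2ℚ * x + (- 2ℚ) * y)) ∑w
             (trans (sym (*-distribʳ-sum w (A i))) (cong (_* w) (A-rowSum i))) ⟩
      1ℚ * (6ℚ * w - 2ℚ) + (2ℚ * 1ℚ + (- 2ℚ) * (3ℚ * w))
        ≡⟨ solve 1 (λ w → con 1ℚ :* (con 6ℚ :* w :- con 2ℚ) :+ (con 2ℚ :* con 1ℚ :+ con (- 2ℚ) :* (con 3ℚ :* w)) := con 0ℚ) refl w ⟩
      0ℚ ∎
    bordered-inverse (suc i) (suc j) = begin
      1ℚ * w + ∑[ k < suc m ] (2ℚ * (1ℚ - A i k) * Q k j)    ≡⟨ cong (_+_ (1ℚ * w)) (∑-bordered A i (λ k → Q k j)) ⟩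
      1ℚ * w + (2ℚ * ∑[ k < suc m ] Q k j + (- 2ℚ) * ∑[ k < suc m ] (A i k * Q k j))
        ≡⟨ cong₂ (λ x y → 1ℚ * w + (2ℚ * x + (- 2ℚ) * y)) (Q-colSum j) (AQ i j) ⟩
      1ℚ * w + (2ℚ * 0ℚ + (- 2ℚ) * (½ * w + (- ½) * δ i j))
        ≡⟨ solve 2 (λ w d → con 1ℚ :* w :+ (con 2ℚ :* con 0ℚ :+ con (- 2ℚ) :* (con ½ :* w :+ con (- ½) :* d)) := d) refl w (δ i j) ⟩
      δ i j ∎

    bordered-sym : ∀ i j → bordered A i j ≡ bordered A j i
    bordered-sym zero    zero    = refl
    bordered-sym zero    (suc j) = refl
    bordered-sym (suc i) zero    = refl
    bordered-sym (suc i) (suc j) = cong (λ a → 2ℚ * (1ℚ - a)) (A-sym i j)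

    inverse-sym : ∀ i j → inverse i j ≡ inverse j i
    inverse-sym zero    zero    = refl
    inverse-sym zero    (suc j) = refl
    inverse-sym (suc i) zero    = refl
    inverse-sym (suc i) (suc j) = cong (λ p → ⅙ * w + (- ½) * p) (P-sym i j)

  bordered-invertible : Invertible ℚ.+-*-commutativeRing (bordered A)
  bordered-invertible = inverse , bordered-inverse ,
    symmetric-inverse ℚ.+-*-commutativeRing {M = bordered A} {B = inverse} bordered-sym inverse-sym bordered-inverse

-- Three-periodic sequences

periodic : ℚ → ℚ → ℚ → ℕ → ℚ
periodic x y z 0 = x
periodic x y z 1 = y
periodic x y z 2 = z
periodic x y z (suc (suc (suc n))) = periodic x y z n

module _ (x y z : ℚ) where

  -- Any three consecutive terms are a cyclic rearrangement of `x`, `y`, `z`.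
  periodic-window : x + y + z ≡ 0ℚ → ∀ n →
    periodic x y z n + periodic x y z (1 ℕ.+ n) + periodic x y z (2 ℕ.+ n) ≡ 0ℚ
  periodic-window x+y+z≡0 0 = x+y+z≡0
  periodic-window x+y+z≡0 1 = trans (solve 3 (λ x y z → y :+ z :+ x := x :+ y :+ z) refl x y z) x+y+z≡0
    where open +-*-Solver
  periodic-window x+y+z≡0 2 = trans (solve 3 (λ x y z → z :+ x :+ y := x :+ y :+ z) refl x y z) x+y+z≡0
    where open +-*-Solver
  periodic-window x+y+z≡0 (suc (suc (suc n))) = periodic-window x+y+z≡0 n

  periodic-shift : ∀ r q → periodic x y z (r ℕ.+ q ℕ.* 3) ≡ periodic x y z r
  periodic-shift r zero    = cong (periodic x y z) (ℕ.+-identityʳ r)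
  periodic-shift r (suc q) = trans
    (cong (periodic x y z) (trans (sym (ℕ.+-assoc r 3 (q ℕ.* 3))) (cong (ℕ._+ q ℕ.* 3) (ℕ.+-comm r 3))))
    (periodic-shift r q)

-- Modulo 3, `d ↦ 1 − d` swaps the residues 0 and 1 and fixes 2, hence the repeated value in the
-- first two places.
periodic-reflect₁ : ∀ {x z} d e q → d ℕ.+ e ≡ 1 ℕ.+ q ℕ.* 3 → periodic x x z d ≡ periodic x x z e
periodic-reflect₁ {x} {z} 0 _ q refl = sym (periodic-shift x x z 1 q)
periodic-reflect₁ {x} {z} 1 _ q refl = sym (periodic-shift x x z 0 q)
periodic-reflect₁ {x} {z} 2 _ (suc q) refl = sym (periodic-shift x x z 2 q)
periodic-reflect₁ (suc (suc (suc d))) e (suc q) eq = periodic-reflect₁ d e q (ℕ.+-cancelˡ-≡ 3 _ _ eq)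

-- Here `d ↦ 2 − d` swaps the residues 0 and 2 and fixes 1.
periodic-reflect₂ : ∀ {x y} d e q → d ℕ.+ e ≡ 2 ℕ.+ q ℕ.* 3 → periodic x y x d ≡ periodic x y x e
periodic-reflect₂ {x} {y} 0 _ q refl = sym (periodic-shift x y x 2 q)
periodic-reflect₂ {x} {y} 1 _ q refl = sym (periodic-shift x y x 1 q)
periodic-reflect₂ {x} {y} 2 _ q refl = sym (periodic-shift x y x 0 q)
periodic-reflect₂ (suc (suc (suc d))) e (suc q) eq = periodic-reflect₂ d e q (ℕ.+-cancelˡ-≡ 3 _ _ eq)

-- The closed neighbourhoods of a cycle

cyclicNext-uniqueʳ : ∀ {m} {i j k : Fin m} → CyclicNext i j → CyclicNext i k → j ≡ k
cyclicNext-uniqueʳ (inj₁ j≡1+i) (inj₁ k≡1+i) = Fin.toℕ-injective (trans j≡1+i (sym k≡1+i))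
cyclicNext-uniqueʳ {j = j} (inj₁ j≡1+i) (inj₂ (1+i≡m , _)) = contradiction (trans j≡1+i 1+i≡m) (ℕ.<⇒≢ (Fin.toℕ<n j))
cyclicNext-uniqueʳ {k = k} (inj₂ (1+i≡m , _)) (inj₁ k≡1+i) = contradiction (trans k≡1+i 1+i≡m) (ℕ.<⇒≢ (Fin.toℕ<n k))
cyclicNext-uniqueʳ (inj₂ (_ , j≡0)) (inj₂ (_ , k≡0)) = Fin.toℕ-injective (trans j≡0 (sym k≡0))

cyclicNext-uniqueˡ : ∀ {m} {i j k : Fin m} → CyclicNext i k → CyclicNext j k → i ≡ j
cyclicNext-uniqueˡ (inj₁ k≡1+i) (inj₁ k≡1+j) = Fin.toℕ-injective (ℕ.suc-injective (trans (sym k≡1+i) k≡1+j))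
cyclicNext-uniqueˡ (inj₁ k≡1+i) (inj₂ (_ , k≡0)) = contradiction (trans (sym k≡1+i) k≡0) λ ()
cyclicNext-uniqueˡ (inj₂ (_ , k≡0)) (inj₁ k≡1+j) = contradiction (trans (sym k≡1+j) k≡0) λ ()
cyclicNext-uniqueˡ (inj₂ (1+i≡m , _)) (inj₂ (1+j≡m , _)) = Fin.toℕ-injective (ℕ.suc-injective (trans 1+i≡m (sym 1+j≡m)))

-- `CyclicNext` on bare numbers: with variables in place of `toℕ i`, the equations can be solved by
-- matching on `refl`.
NextModulo : ℕ → ℕ → ℕ → Set
NextModulo m a b = b ≡ suc a ⊎ (suc a ≡ m × b ≡ 0)

-- At most one of the three steps wraps around, which would give m ≡ 3 or toℕ i ≡ 3 + toℕ i.
cyclicNext-no3cycle : ∀ {m} → 4 ≤ m → {i j k : Fin m} → CyclicNext i j → CyclicNext j k → ¬ CyclicNext k i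
cyclicNext-no3cycle 4≤m {i} {j} {k} = go (toℕ i) (toℕ j) (toℕ k) 4≤m
  where
  go : ∀ {m} a b c → 4 ≤ m → NextModulo m a b → NextModulo m b c → ¬ NextModulo m c a
  go a _ _ _ (inj₁ refl) (inj₁ refl) (inj₁ ())
  go .0 _ _ (s≤s (s≤s (s≤s ()))) (inj₁ refl) (inj₁ refl) (inj₂ (refl , refl))
  go _ _ _ (s≤s (s≤s (s≤s ()))) (inj₁ refl) (inj₂ (refl , refl)) (inj₁ refl)
  go _ _ _ _ (inj₁ refl) (inj₂ (refl , refl)) (inj₂ (() , _))
  go _ _ _ (s≤s (s≤s (s≤s ()))) (inj₂ (refl , refl)) (inj₁ refl) (inj₁ refl)

-- Returning after two steps either wraps around, which forces `m` to be at most 2, or gives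
-- `toℕ i ≡ 2 + toℕ i`.
cyclicNext-asym : ∀ {m} → 3 ≤ m → {i j : Fin m} → CyclicNext i j → ¬ CyclicNext j i
cyclicNext-asym 3≤m {i} {j} = go (toℕ i) (toℕ j) 3≤m
  where
  go : ∀ {m} a b → 3 ≤ m → NextModulo m a b → ¬ NextModulo m b a
  go _ _ _ (inj₁ refl) (inj₁ ())
  go _ _ (s≤s (s≤s ())) (inj₁ refl) (inj₂ (refl , refl))
  go _ _ (s≤s (s≤s ())) (inj₂ (refl , refl)) (inj₁ refl)

next : ∀ {m} (i : Fin (suc m)) → ∃ (CyclicNext i)
next {m} i with suc (toℕ i) ℕ.<? suc m
... | yes 1+i<m = fromℕ< 1+i<m , inj₁ (Fin.toℕ-fromℕ< 1+i<m)
... | no  1+i≮m = zero , inj₂ (ℕ.≤-antisym (Fin.toℕ<n i) (ℕ.≮⇒≥ 1+i≮m) , refl)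

prev : ∀ {m} (i : Fin (suc m)) → ∃ λ j → CyclicNext j i
prev {m} zero    = fromℕ< (ℕ.n<1+n m) , inj₂ (cong suc (Fin.toℕ-fromℕ< (ℕ.n<1+n m)) , refl)
prev     (suc i) = inject₁ i , inj₁ (cong suc (sym (Fin.toℕ-inject₁ i)))

-- Written with deltas instead of a test for adjacency, so that sums against a row collapse to three
-- terms. On very short cycles the entries count multiplicities, and the row sum stays 3.
closedNeighbourhood : ∀ {m} → Matrix ℚ (suc m)
closedNeighbourhood i j = δ i j + δ (proj₁ (next i)) j + δ (proj₁ (prev i)) j

module _ {m : ℕ} where

  private
    A : Matrix ℚ (suc m)
    A = closedNeighbourhood

  closedNeighbourhood-sym : ∀ i j → A i j ≡ A j i
  closedNeighbourhood-sym i j = begin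
    δ i j + δ (proj₁ (next i)) j + δ (proj₁ (prev i)) j
      ≡⟨ cong₂ _+_ (cong₂ _+_ (δ-cong {i = i} {j} sym sym) (next⇔prev i j)) (sym (next⇔prev j i)) ⟩
    δ j i + δ (proj₁ (prev j)) i + δ (proj₁ (next j)) i
      ≡⟨ solve 3 (λ a b c → a :+ b :+ c := a :+ c :+ b) refl (δ j i) _ _ ⟩
    δ j i + δ (proj₁ (next j)) i + δ (proj₁ (prev j)) i ∎
    where
    open ≡-Reasoning
    open +-*-Solver
    next⇔prev : ∀ i j → δ (proj₁ (next i)) j ≡ δ (proj₁ (prev j)) i
    next⇔prev i j = δ-cong {i = proj₁ (next i)} {j} {proj₁ (prev j)} {i}
      (λ { refl → cyclicNext-uniqueˡ (proj₂ (prev j)) (proj₂ (next i)) })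
      (λ { refl → cyclicNext-uniqueʳ (proj₂ (next i)) (proj₂ (prev j)) })

  ∑-closedNeighbourhood : ∀ i (v : Fin (suc m) → ℚ) →
    ∑[ k < suc m ] (A i k * v k) ≡ v i + v (proj₁ (next i)) + v (proj₁ (prev i))
  ∑-closedNeighbourhood i v = begin
    ∑[ k < suc m ] (A i k * v k)
      ≡⟨ sum-cong-≗ (λ k → trans (ℚ.*-distribʳ-+ (v k) (δ i k + δ i⁺ k) (δ i⁻ k)) (cong (_+ δ i⁻ k * v k) (ℚ.*-distribʳ-+ (v k) (δ i k) (δ i⁺ k)))) ⟩
    ∑[ k < suc m ] (δ i k * v k + δ i⁺ k * v k + δ i⁻ k * v k)
      ≡⟨ ∑-distrib-+ (λ k → δ i k * v k + δ i⁺ k * v k) (λ k → δ i⁻ k * v k) ⟩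
    ∑[ k < suc m ] (δ i k * v k + δ i⁺ k * v k) + ∑[ k < suc m ] (δ i⁻ k * v k)
      ≡⟨ cong₂ _+_ (trans (∑-distrib-+ (λ k → δ i k * v k) (λ k → δ i⁺ k * v k)) (cong₂ _+_ (∑δ i) (∑δ i⁺))) (∑δ i⁻) ⟩
    v i + v i⁺ + v i⁻ ∎
    where
    open ≡-Reasoning
    i⁺ = proj₁ (next i)
    i⁻ = proj₁ (prev i)
    ∑δ : ∀ i → ∑[ k < suc m ] (δ i k * v k) ≡ v i
    ∑δ i = sum-identityMatrix ℚ.+-*-commutativeRing i v

  closedNeighbourhood-rowSum : ∀ i → sum (A i) ≡ 3ℚ
  closedNeighbourhood-rowSum i = trans (sum-cong-≗ λ k → sym (ℚ.*-identityʳ (A i k)))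
    (∑-closedNeighbourhood i (λ _ → 1ℚ))

  -- The entry at vertex k is F (1 + k), so that the window around i starts at F i
  -- and no predecessor of 0 is needed.
  ∑-closedNeighbourhood-window : (F : ℕ → ℚ) → F 0 ≡ F (suc m) → F 1 ≡ F (suc (suc m)) →
    ∀ i → ∑[ k < suc m ] (A i k * F (suc (toℕ k))) ≡ F (toℕ i) + F (suc (toℕ i)) + F (suc (suc (toℕ i)))
  ∑-closedNeighbourhood-window F F₀ F₁ i = begin
    ∑[ k < suc m ] (A i k * F (suc (toℕ k)))
      ≡⟨ ∑-closedNeighbourhood i (λ k → F (suc (toℕ k))) ⟩
    F (suc (toℕ i)) + F (suc (toℕ (proj₁ (next i)))) + F (suc (toℕ (proj₁ (prev i))))
      ≡⟨ cong₂ (λ x y → F (suc (toℕ i)) + x + y) (F-next (proj₂ (next i))) (F-prev (proj₂ (prev i))) ⟩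
    F (suc (toℕ i)) + F (suc (suc (toℕ i))) + F (toℕ i)
      ≡⟨ solve 3 (λ a b c → b :+ c :+ a := a :+ b :+ c) refl (F (toℕ i)) (F (suc (toℕ i))) (F (suc (suc (toℕ i)))) ⟩
    F (toℕ i) + F (suc (toℕ i)) + F (suc (suc (toℕ i))) ∎
    where
    open ≡-Reasoning
    open +-*-Solver
    F-next : ∀ {j} → CyclicNext i j → F (suc (toℕ j)) ≡ F (suc (suc (toℕ i)))
    F-next (inj₁ j≡1+i) = cong (F ∘ suc) j≡1+i
    -- The successor of the last vertex is vertex 0, whose entry `F 1` must agree with the term one
    -- past the end.
    F-next (inj₂ (1+i≡m , j≡0)) = trans (cong (F ∘ suc) j≡0) (trans F₁ (cong (F ∘ suc) (sym 1+i≡m)))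
    F-prev : ∀ {j} → CyclicNext j i → F (suc (toℕ j)) ≡ F (toℕ i)
    F-prev (inj₁ i≡1+j) = cong F (sym i≡1+j)
    F-prev (inj₂ (1+j≡m , i≡0)) = trans (cong F 1+j≡m) (trans (sym F₀) (cong F (sym i≡0)))

  module _ (p : ℕ → ℚ) (p-window : ∀ n → p n + p (1 ℕ.+ n) + p (2 ℕ.+ n) ≡ 0ℚ)
    (p-centre : p 1 + p 0 + p 1 ≡ 1ℚ) (p-reflect : ∀ d e → d ℕ.+ e ≡ suc m → p d ≡ p e) where

    private
      P : Matrix ℚ (suc m)
      P i j = p ℕ.∣ toℕ i - toℕ j ∣

      -- On the diagonal the three distances are 1, 0, 1; off it they are consecutive numbers, in
      -- one order or the other.
      window : ∀ a b → p ℕ.∣ a - suc b ∣ + p ℕ.∣ a - b ∣ + p ℕ.∣ suc a - b ∣ ≡ (if does (a ℕ.≟ b) then 1ℚ else 0ℚ)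
      window zero    zero    = p-centre
      window zero    (suc b) = trans (solve 3 (λ x y z → z :+ y :+ x := x :+ y :+ z) refl (p b) (p (suc b)) (p (suc (suc b)))) (p-window b)
        where open +-*-Solver
      window (suc a) zero    = trans (cong (λ n → p n + p (suc a) + p (suc (suc a))) (ℕ.∣-∣-identityʳ a)) (p-window a)
      window (suc a) (suc b) = window a b

      reflect : ∀ {b} → b ≤ suc m → p b ≡ p ℕ.∣ suc m - b ∣
      reflect {b} b≤m = p-reflect b ℕ.∣ suc m - b ∣ (trans (cong (b ℕ.+_) (ℕ.m≤n⇒∣n-m∣≡n∸m b≤m)) (ℕ.m+[n∸m]≡n b≤m))

      inverts : ∀ i j → ∑[ k < suc m ] (A i k * P k j) ≡ δ i j
      inverts i j = begin
        ∑[ k < suc m ] (A i k * P k j)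
          -- With this `F`, the value `F (1 + k)` is `P k j`, and the two wrap-around conditions are
          -- the reflections of `p` at `1 + j` and at `j`.
          ≡⟨ ∑-closedNeighbourhood-window (λ x → p ℕ.∣ x - suc (toℕ j) ∣) (reflect (Fin.toℕ<n j)) (reflect (ℕ.<⇒≤ (Fin.toℕ<n j))) i ⟩
        p ℕ.∣ toℕ i - suc (toℕ j) ∣ + p ℕ.∣ toℕ i - toℕ j ∣ + p ℕ.∣ suc (toℕ i) - toℕ j ∣
          ≡⟨ window (toℕ i) (toℕ j) ⟩
        (if does (toℕ i ℕ.≟ toℕ j) then 1ℚ else 0ℚ)
          ≡⟨ cong (if_then 1ℚ else 0ℚ) (does-⇔ (mk⇔ Fin.toℕ-injective (cong toℕ)) (toℕ i ℕ.≟ toℕ j) (i Fin.≟ j)) ⟩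
        δ i j ∎
        where open ≡-Reasoning

    bordered-closedNeighbourhood-invertible : Invertible ℚ.+-*-commutativeRing (bordered A)
    bordered-closedNeighbourhood-invertible = bordered-invertible A P closedNeighbourhood-sym
      (λ i j → cong p (ℕ.∣-∣-comm (toℕ i) (toℕ j))) closedNeighbourhood-rowSum inverts

  -- Kernel vector and inverse according to the residue of `n` modulo 3

  rimSequence : ℕ → ℚ
  rimSequence = periodic 0ℚ 1ℚ (- 1ℚ)

  rimVector : Fin (suc m) → ℚ
  rimVector k = rimSequence (suc (toℕ k))

  bordered-singular : suc (suc m) % 3 ≡ 1 → ∀ i → ∑[ k < suc (suc m) ] (bordered A i k * (0ℚ Vector.∷ rimVector) k) ≡ 0ℚ
  bordered-singular n%3≡1 = bordered-kernel A rimVector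
    (subst (λ l → ∑[ k < l ] rimSequence (suc (toℕ k)) ≡ 0ℚ) (sym 1+m≡q*3) (sum≡0 q))
    (λ i → trans (∑-closedNeighbourhood-window rimSequence (shift 0) (shift 1) i)
                 (periodic-window 0ℚ 1ℚ (- 1ℚ) refl (toℕ i)))
    where
    q : ℕ
    q = suc (suc m) ℕ./ 3

    1+m≡q*3 : suc m ≡ q ℕ.* 3
    1+m≡q*3 = ℕ.suc-injective (trans (m≡m%n+[m/n]*n (suc (suc m)) 3) (cong (ℕ._+ q ℕ.* 3) n%3≡1))

    shift : ∀ r → rimSequence r ≡ rimSequence (r ℕ.+ suc m)
    shift r = sym (trans (cong (λ l → rimSequence (r ℕ.+ l)) 1+m≡q*3) (periodic-shift 0ℚ 1ℚ (- 1ℚ) r q))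

    sum≡0 : ∀ q → ∑[ k < q ℕ.* 3 ] rimSequence (suc (toℕ k)) ≡ 0ℚ
    sum≡0 zero    = refl
    -- The first period contributes `1 − 1 + 0`; by periodicity the rest reduces to the sum over `q`
    -- periods.
    sum≡0 (suc q) = cong (λ s → 1ℚ + (- 1ℚ + (0ℚ + s))) (sum≡0 q)

  bordered-nonsingular : suc (suc m) % 3 ≢ 1 → Invertible ℚ.+-*-commutativeRing (bordered A)
  bordered-nonsingular n%3≢1 = go (suc (suc m) % 3) (suc (suc m) ℕ./ 3) n%3≢1
    (m%n<n (suc (suc m)) 3) (m≡m%n+[m/n]*n (suc (suc m)) 3)
    where
    -- Residue and quotient become variables here, so that the residue can be matched.
    go : ∀ r q → r ≢ 1 → r ℕ.< 3 → suc (suc m) ≡ r ℕ.+ q ℕ.* 3 → Invertible ℚ.+-*-commutativeRing (bordered A)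
    -- The cycle length is `2 + q * 3`, so reflection demands `p 0 = p 2`. Together with a zero sum
    -- over a period and `p 0 + 2 p 1 = 1` this determines `p`.
    go 0 (suc q) _ _ n≡ = bordered-closedNeighbourhood-invertible (periodic (- ⅓) (⅓ + ⅓) (- ⅓))
      (periodic-window (- ⅓) (⅓ + ⅓) (- ⅓) refl) refl
      (λ d e d+e≡ → periodic-reflect₂ d e q (trans d+e≡ (ℕ.suc-injective n≡)))
    go 1 _ r≢1 _ _ = contradiction refl r≢1
    -- The cycle length is `1 + q * 3`: now `p 0 = p 1`, and `p 0 + 2 p 1 = 1` gives `⅓` for both.
    go 2 q _ _ n≡ = bordered-closedNeighbourhood-invertible (periodic ⅓ ⅓ (- (⅓ + ⅓)))
      (periodic-window ⅓ ⅓ (- (⅓ + ⅓)) refl) refl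
      (λ d e d+e≡ → periodic-reflect₁ d e q (trans d+e≡ (ℕ.suc-injective n≡)))
    go (suc (suc (suc _))) _ _ (s≤s (s≤s (s≤s ()))) _

-- Distances and eccentricities

≤foldr-⊔ : ∀ {n} (f : Fin n → ℕ) i → f i ≤ Vector.foldr ℕ._⊔_ 0 f
≤foldr-⊔ f zero    = ℕ.m≤m⊔n (f zero) _
≤foldr-⊔ f (suc i) = ℕ.≤-trans (≤foldr-⊔ (f ∘ suc) i) (ℕ.m≤n⊔m (f zero) _)

foldr-⊔≤ : ∀ {n k} (f : Fin n → ℕ) → (∀ i → f i ≤ k) → Vector.foldr ℕ._⊔_ 0 f ≤ k
foldr-⊔≤ {zero}  f f≤k = z≤n
foldr-⊔≤ {suc n} f f≤k = ℕ.⊔-lub (f≤k zero) (foldr-⊔≤ (f ∘ suc) (f≤k ∘ suc))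

-- The matrix entry as a function of three numbers: once these are literals, the test inside it
-- computes.
eccentricityEntry : ℕ → ℕ → ℕ → ℝ
eccentricityEntry d e e′ = if does (d ℕ.≟ e ℕ.⊓ e′) then fromℕ d else 0ℝ

module _ {n} (G : SimpleGraph n) (conn : Connected G) where
  open SimpleGraph G

  -- `distance` is itself a least path length, so the two minimality statements bound each other,
  -- whatever bound the search started from.
  distance-unique : ∀ u v {k} → HasPath G u v k → (∀ j → HasPath G u v j → k ≤ j) → distance G conn u v ≡ k
  distance-unique u v path shortest =
    let k , connPath = conn u v
        d , d-path , d-shortest = least (hasPath? G u v) k connPath
    in ℕ.≤-antisym (d-shortest _ path) (shortest d d-path)

  eccentricity-unique : ∀ u v {k} → distance G conn u v ≡ k → (∀ w → distance G conn u w ≤ k) → eccentricity G conn u ≡ k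
  eccentricity-unique u v refl d≤k = ℕ.≤-antisym (foldr-⊔≤ _ d≤k) (≤foldr-⊔ (distance G conn u) v)

  hasPath₀ : ∀ {u v} → HasPath G u v 0 → u ≡ v
  hasPath₀ (_ ∷ [] , isPath refl refl _ _) = refl

  hasPath₁ : ∀ {u v} → HasPath G u v 1 → Adj u v
  hasPath₁ (_ ∷ _ ∷ [] , isPath refl refl (a ∷ _) _) = a

  distance-self : ∀ u → distance G conn u u ≡ 0
  distance-self u = distance-unique u u (u ∷ [] , isPath refl refl [-] ([] ∷ [])) λ _ _ → z≤n

  distance-adjacent : ∀ u v → Adj u v → distance G conn u v ≡ 1
  distance-adjacent u v a = distance-unique u v
    (u ∷ v ∷ [] , isPath refl refl (a ∷ [-]) ((u≢v ∷ []) ∷ [] ∷ []))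
    λ { zero path → contradiction (hasPath₀ path) u≢v ; (suc _) _ → s≤s z≤n }
    where
    u≢v : u ≢ v
    u≢v refl = irrefl u a

  distance-commonNeighbour : ∀ u v w → u ≢ w → ¬ Adj u w → Adj u v → Adj v w → distance G conn u w ≡ 2
  distance-commonNeighbour u v w u≢w ¬a a b = distance-unique u w
    (u ∷ v ∷ w ∷ [] , isPath refl refl (a ∷ b ∷ [-])
      (((λ { refl → irrefl u a }) ∷ u≢w ∷ []) ∷ ((λ { refl → irrefl v b }) ∷ []) ∷ [] ∷ []))
    λ { zero path → contradiction (hasPath₀ path) u≢w
      ; (suc zero) path → contradiction (hasPath₁ path) ¬a
      ; (suc (suc _)) _ → s≤s (s≤s z≤n) }

  eccentricityMatrix-entry : ∀ i j {d e e′} → distance G conn i j ≡ d →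
    eccentricity G conn i ≡ e → eccentricity G conn j ≡ e′ → eccentricityMatrix G conn i j ≡ eccentricityEntry d e e′
  eccentricityMatrix-entry i j refl refl refl = refl

-- Eccentricities and matrix entries of the wheel

-- The graph is only assumed to have the adjacency of the wheel: with the wheel itself,
-- Agda would compare distances by unfolding the path search.
module _ {m} (4≤m : 4 ≤ suc m) (G : SimpleGraph (suc (suc m))) (conn : Connected G)
  (WheelAdj⇒Adj : ∀ u v → WheelAdj u v → SimpleGraph.Adj G u v)
  (Adj⇒WheelAdj : ∀ u v → SimpleGraph.Adj G u v → WheelAdj u v) where

  private
    n : ℕ
    n = suc (suc m)

    d : Fin n → Fin n → ℕ
    d = distance G conn

    e : Fin n → ℕ
    e = eccentricity G conn

    A : Matrix ℚ (suc m)
    A = closedNeighbourhood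

    cyclicNext-irrefl : ∀ (i : Fin (suc m)) → ¬ CyclicNext i i
    cyclicNext-irrefl i i→i = SimpleGraph.irrefl G (suc i) (WheelAdj⇒Adj (suc i) (suc i) (inj₁ i→i))

    d-nonadjacent : ∀ i j → i ≢ j → ¬ (CyclicNext i j ⊎ CyclicNext j i) → d (suc i) (suc j) ≡ 2
    d-nonadjacent i j i≢j ¬a = distance-commonNeighbour G conn (suc i) zero (suc j)
      (i≢j ∘ Fin.suc-injective) (¬a ∘ Adj⇒WheelAdj (suc i) (suc j)) (WheelAdj⇒Adj (suc i) zero tt) (WheelAdj⇒Adj zero (suc j) tt)

    -- The cases are the distances 0, 1 and 2 between rim vertices: the hub is a neighbour of all of
    -- them, so no distance is larger.
    data CyclePair (i j : Fin (suc m)) : Set where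
      equal       : i ≡ j → CyclePair i j
      consecutive : CyclicNext i j ⊎ CyclicNext j i → CyclePair i j
      apart       : i ≢ j → ¬ (CyclicNext i j ⊎ CyclicNext j i) → CyclePair i j

    cyclePair : ∀ i j → CyclePair i j
    cyclePair i j with i Fin.≟ j | SimpleGraph.adj? G (suc i) (suc j)
    ... | yes i≡j | _      = equal i≡j
    ... | no  _   | yes a  = consecutive (Adj⇒WheelAdj (suc i) (suc j) a)
    ... | no  i≢j | no  ¬a = apart i≢j (¬a ∘ WheelAdj⇒Adj (suc i) (suc j))

    d-adjacent : ∀ u v → WheelAdj u v → d u v ≡ 1
    d-adjacent u v a = distance-adjacent G conn u v (WheelAdj⇒Adj u v a)

    e-hub : e zero ≡ 1
    e-hub = eccentricity-unique G conn zero (suc zero) (d-adjacent zero (suc zero) tt) λ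
      { zero    → subst (_≤ 1) (sym (distance-self G conn zero)) z≤n
      ; (suc j) → ℕ.≤-reflexive (d-adjacent zero (suc j) tt) }

    -- The vertex two steps further along the cycle attains the maximum. A rim of length at least 4
    -- is essential: on a triangle that vertex would be adjacent to `i`.
    e-rim : ∀ i → e (suc i) ≡ 2
    e-rim i = eccentricity-unique G conn (suc i) (suc i⁺⁺) (d-nonadjacent i i⁺⁺ i≢i⁺⁺ ¬a) λ
      { zero    → subst (_≤ 2) (sym (d-adjacent (suc i) zero tt)) (s≤s z≤n)
      ; (suc j) → d≤2 j (cyclePair i j) }
      where
      i⁺ = proj₁ (next i)
      i→i⁺ = proj₂ (next i)
      i⁺⁺ = proj₁ (next i⁺)
      i⁺→i⁺⁺ = proj₂ (next i⁺)
      i≢i⁺⁺ : i ≢ i⁺⁺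
      i≢i⁺⁺ i≡i⁺⁺ = cyclicNext-asym (<⇒≤ 4≤m) i→i⁺ (subst (CyclicNext i⁺) (sym i≡i⁺⁺) i⁺→i⁺⁺)
      ¬a : ¬ (CyclicNext i i⁺⁺ ⊎ CyclicNext i⁺⁺ i)
      ¬a (inj₁ i→i⁺⁺) = cyclicNext-irrefl i⁺ (subst (CyclicNext i⁺) (cyclicNext-uniqueʳ i→i⁺⁺ i→i⁺) i⁺→i⁺⁺)
      ¬a (inj₂ i⁺⁺→i) = cyclicNext-no3cycle 4≤m i→i⁺ i⁺→i⁺⁺ i⁺⁺→i
      d≤2 : ∀ j → CyclePair i j → d (suc i) (suc j) ≤ 2
      d≤2 _ (equal refl)     = subst (_≤ 2) (sym (distance-self G conn (suc i))) z≤n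
      d≤2 j (consecutive a)  = subst (_≤ 2) (sym (d-adjacent (suc i) (suc j) a)) (s≤s z≤n)
      d≤2 j (apart i≢j ¬a)   = ℕ.≤-reflexive (d-nonadjacent i j i≢j ¬a)

    δ-next-≡ : ∀ (i j : Fin (suc m)) → CyclicNext i j → δ (proj₁ (next i)) j ≡ 1ℚ
    δ-next-≡ i j i→j = δ-≡ (cyclicNext-uniqueʳ (proj₂ (next i)) i→j)

    δ-prev-≡ : ∀ (i j : Fin (suc m)) → CyclicNext j i → δ (proj₁ (prev i)) j ≡ 1ℚ
    δ-prev-≡ i j j→i = δ-≡ (cyclicNext-uniqueˡ (proj₂ (prev i)) j→i)

    δ-next-≢ : ∀ (i j : Fin (suc m)) → ¬ CyclicNext i j → δ (proj₁ (next i)) j ≡ 0ℚ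
    δ-next-≢ i j ¬i→j = δ-≢ λ i⁺≡j → ¬i→j (subst (CyclicNext i) i⁺≡j (proj₂ (next i)))

    δ-prev-≢ : ∀ (i j : Fin (suc m)) → ¬ CyclicNext j i → δ (proj₁ (prev i)) j ≡ 0ℚ
    δ-prev-≢ i j ¬j→i = δ-≢ λ i⁻≡j → ¬j→i (subst (λ k → CyclicNext k i) i⁻≡j (proj₂ (prev i)))

    A-equal : ∀ i → A i i ≡ 1ℚ
    A-equal i = cong₂ _+_
      (cong₂ _+_ (δ-≡ {i = i} refl) (δ-next-≢ i i (cyclicNext-irrefl i))) (δ-prev-≢ i i (cyclicNext-irrefl i))

    -- Asymmetry keeps `j` from being both successor and predecessor of `i`, so the entry is 1 and
    -- not 2.
    A-consecutive : ∀ i j → CyclicNext i j ⊎ CyclicNext j i → A i j ≡ 1ℚ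
    A-consecutive i j (inj₁ i→j) = cong₂ _+_
      (cong₂ _+_ (δ-≢ {i = i} λ { refl → cyclicNext-irrefl i i→j }) (δ-next-≡ i j i→j))
      (δ-prev-≢ i j (cyclicNext-asym (<⇒≤ 4≤m) i→j))
    A-consecutive i j (inj₂ j→i) = cong₂ _+_
      (cong₂ _+_ (δ-≢ {i = i} λ { refl → cyclicNext-irrefl i j→i }) (δ-next-≢ i j (cyclicNext-asym (<⇒≤ 4≤m) j→i)))
      (δ-prev-≡ i j j→i)

    A-apart : ∀ i j → i ≢ j → ¬ (CyclicNext i j ⊎ CyclicNext j i) → A i j ≡ 0ℚ
    A-apart i j i≢j ¬a = cong₂ _+_
      (cong₂ _+_ (δ-≢ i≢j) (δ-next-≢ i j (¬a ∘ inj₁))) (δ-prev-≢ i j (¬a ∘ inj₂))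

    entry : ∀ i j {k a b} → d i j ≡ k → e i ≡ a → e j ≡ b →
      eccentricityEntry k a b ≈ℝ constℝ (bordered A i j) → eccentricityMatrix G conn i j ≈ℝ constℝ (bordered A i j)
    entry i j d≡ e≡ e′≡ = subst (_≈ℝ constℝ (bordered A i j)) (sym (eccentricityMatrix-entry G conn i j d≡ e≡ e′≡))

    -- The value of `A i j` is a separate argument `a`, so that the comparison with `2ℚ * (1ℚ - a)`
    -- is between closed terms.
    rimEntry : ∀ i j {k a} → d (suc i) (suc j) ≡ k → eccentricityEntry k 2 2 ≈ℝ constℝ (2ℚ * (1ℚ - a)) → A i j ≡ a →
      eccentricityMatrix G conn (suc i) (suc j) ≈ℝ constℝ (bordered A (suc i) (suc j))
    rimEntry i j d≡ entry≈ refl = entry (suc i) (suc j) d≡ (e-rim i) (e-rim j) entry≈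

    rimEntries : ∀ i j → CyclePair i j →
      eccentricityMatrix G conn (suc i) (suc j) ≈ℝ constℝ (bordered A (suc i) (suc j))
    -- Distances 0 and 1 differ from `2 ⊓ 2` and are replaced by 0, in agreement with `A i j = 1`;
    -- only distance 2 survives.
    rimEntries i _ (equal refl) = rimEntry i i (distance-self G conn (suc i)) (constℝ-cong {0ℚ} {2ℚ * (1ℚ - 1ℚ)} refl) (A-equal i)
    rimEntries i j (consecutive a) = rimEntry i j (d-adjacent (suc i) (suc j) a) (constℝ-cong {0ℚ} {2ℚ * (1ℚ - 1ℚ)} refl) (A-consecutive i j a)
    rimEntries i j (apart i≢j ¬a) = rimEntry i j (d-nonadjacent i j i≢j ¬a) (constℝ-cong {2ℚ} {2ℚ * (1ℚ - 0ℚ)} refl) (A-apart i j i≢j ¬a)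

  wheel-eccentricityMatrix : ∀ i j →
    eccentricityMatrix G conn i j ≈ℝ constℝ (bordered (closedNeighbourhood {m}) i j)
  -- In the border the minimum is 1: the diagonal distance 0 is dropped and every hub distance 1 is
  -- kept.
  wheel-eccentricityMatrix zero    zero    = entry zero zero (distance-self G conn zero) e-hub e-hub ≈ℝ-refl
  wheel-eccentricityMatrix zero    (suc j) = entry zero (suc j) (d-adjacent zero (suc j) tt) e-hub (e-rim j) ≈ℝ-refl
  wheel-eccentricityMatrix (suc i) zero    = entry (suc i) zero (d-adjacent (suc i) zero tt) (e-rim i) e-hub ≈ℝ-refl
  wheel-eccentricityMatrix (suc i) (suc j) = rimEntries i j (cyclePair i j)

theorem3p5 : (n : ℕ) (5≤n : 5 ≤ n) →
    Invertible ℝ-commutativeRing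
    (eccentricityMatrix (wheel n (<⇒≤ 5≤n)) (wheel-connected n (<⇒≤ 5≤n)))
    ⇔ (n % 3 ≢ 1)
theorem3p5 (suc zero) (s≤s ())
theorem3p5 n@(suc (suc m)) 5≤n = mk⇔
  (λ invertible n%3≡1 → singular-constℝ entries (0ℚ Vector.∷ rimVector) (bordered-singular n%3≡1)
    -- The first rim vertex, where the kernel vector has the entry 1.
    (suc zero) refl invertible)
  (λ n%3≢1 → Invertible-constℝ entries (bordered-nonsingular n%3≢1))
  where
  entries : ∀ i j → eccentricityMatrix (wheel n (<⇒≤ 5≤n)) (wheel-connected n (<⇒≤ 5≤n)) i j
                    ≈ℝ constℝ (bordered (closedNeighbourhood {m}) i j)
  entries = wheel-eccentricityMatrix (ℕ.s≤s⁻¹ 5≤n)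
    (wheel n (<⇒≤ 5≤n)) (wheel-connected n (<⇒≤ 5≤n)) (λ _ _ a → a) (λ _ _ a → a)
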